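{- (1) If the disjointness matrix $R_d=\begin{bmatrix}1&1\\1&0\end{bmatrix}^{\otimes d}$, of side-length $N=2^d$, does not have (as $d\to\infty$) depth-2 linear circuits over $\mathbb{R}$ of size $N^{1+o(1)}$, then the Boolean Inner Product function on $n$-bit vectors does not have (as $n\to\infty$) $\mathsf{SUM}\circ\mathsf{ETHR}$ circuits of size $2^{o(n)}$. (2) If the Walsh--Hadamard matrix $H_d=\begin{bmatrix}1&1\\1&-1\end{bmatrix}^{\otimes d}$, of side-length $N=2^d$, does not have (as $d\to\infty$) depth-2 linear circuits over $\mathbb{R}$ of size $N^{1+o(1)}$, then the Boolean Inner Product Mod 2 function on $n$-bit vectors does not have (as $n\to\infty$) $\mathsf{SUM}\circ\mathsf{ETHR}$ circuits of size $2^{o(n)}$.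
   Context: $A^{\otimes d}$ is the $d$-fold Kronecker power; $\operatorname{nnz}$ counts nonzero entries. A depth-2 linear circuit over $\mathbb{R}$ computing $M$ is a factorization $M=UV^{\mathsf T}$ over $\mathbb{R}$; its size is $\operatorname{nnz}(U)+\operatorname{nnz}(V)$. Boolean Inner Product is the function $\{0,1\}^n\times\{0,1\}^n\to\{0,1\}$, $(x,y)\mapsto\bigvee_{i=1}^n(x_i\wedge y_i)$. Boolean Inner Product Mod 2 is $(x,y)\mapsto\sum_{i=1}^n x_iy_i \bmod 2$. An exact threshold ($\mathsf{ETHR}$) gate on Boolean inputs $z_1,\dots,z_\ell$ outputs $1$ if $\sum_i w_iz_i=t$ for prescribed $w_i,t\in\mathbb{R}$, and $0$ otherwise. A $\mathsf{SUM}\circ\mathsf{ETHR}$ circuit has a bottom layer of $\mathsf{ETHR}$ gates reading the inputs and a top gate that outputs a fixed real linear combination of the values of the bottom gates; it computes a Boolean function $g$ if its output equals $g$ on every input. Its size is the number of gates. -}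

module Defs where

open import Level using (Level; _⊔_) renaming (suc to lsuc)
open import Algebra.Bundles using (CommutativeRing)
open import Algebra.Core using (Op₁; Op₂)
open import Algebra.Structures using (IsCommutativeRing)
import Algebra.Properties.Monoid.Sum as MonoidSum
open import Data.Bool.Base using (Bool; false; _∧_; _∨_; if_then_else_)
open import Data.Fin.Base using (Fin; quotient; remainder)
open import Data.Integer.Base using (+_; -[1+_])
open import Data.Nat.Base as ℕ using (ℕ; zero; suc)
open import Data.Nat.DivMod using (_%_)
import Data.Nat.Properties as ℕ
open import Data.Product.Base using (_×_; ∃; ∃-syntax)
open import Data.Rational.Unnormalised.Base as ℚᵘ using (ℚᵘ; mkℚᵘ; 0ℚᵘ; 1ℚᵘ)
open import Data.Vec.Functional using (Vector; []; _∷_; _++_; foldr; zipWith)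
open import Relation.Binary.Core using (Rel)
open import Relation.Binary.PropositionalEquality.Core using (_≡_)
open import Relation.Binary.Structures using (IsDecTotalOrder)
open import Relation.Nullary.Decidable.Core using (does)
open import Relation.Nullary.Negation.Core using (¬_)
open import Relation.Unary using (Pred)

open MonoidSum ℕ.+-0-monoid using () renaming (sum to sumℕ)

------------------------------------------------------------------------
-- The real numbers

-- The classical real numbers, given by their axioms: a Dedekind-complete
-- totally ordered field.  As usual in classical mathematics the order
-- (and hence equality) is decidable; this is what makes the number of
-- nonzero entries of a matrix and the output of a threshold gate
-- well-defined.

record RealNumbers (c ℓ₁ ℓ₂ : Level) : Set (lsuc (c ⊔ ℓ₁ ⊔ ℓ₂)) where
  infix  8 -_
  infixl 7 _*_
  infixl 6 _+_
  infix  4 _≈_ _≤_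
  field
    Carrier           : Set c
    _≈_               : Rel Carrier ℓ₁
    _≤_               : Rel Carrier ℓ₂
    _+_               : Op₂ Carrier
    _*_               : Op₂ Carrier
    -_                : Op₁ Carrier
    0#                : Carrier
    1#                : Carrier
    isCommutativeRing : IsCommutativeRing _≈_ _+_ _*_ -_ 0# 1#
    1≉0               : ¬ (1# ≈ 0#)
    inverse           : ∀ x → ¬ (x ≈ 0#) → ∃[ y ] x * y ≈ 1#
    isDecTotalOrder   : IsDecTotalOrder _≈_ _≤_
    +-monoˡ-≤         : ∀ x y z → x ≤ y → x + z ≤ y + z
    *-nonNeg          : ∀ x y → 0# ≤ x → 0# ≤ y → 0# ≤ x * y

  UpperBound : Pred Carrier (c ⊔ ℓ₁ ⊔ ℓ₂) → Carrier → Set (c ⊔ ℓ₁ ⊔ ℓ₂)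
  UpperBound S b = ∀ x → S x → x ≤ b

  field
    complete : ∀ (S : Pred Carrier (c ⊔ ℓ₁ ⊔ ℓ₂)) → ∃ S → ∃ (UpperBound S) →
               ∃[ s ] (UpperBound S s × (∀ b → UpperBound S b → s ≤ b))

  commutativeRing : CommutativeRing c ℓ₁
  commutativeRing = record { isCommutativeRing = isCommutativeRing }

  open CommutativeRing commutativeRing public using (+-monoid)
  open IsDecTotalOrder isDecTotalOrder public using (_≟_)

------------------------------------------------------------------------
-- Asymptotic notation

-- `x ≤[ b ^ q ]` is the real inequality x ≤ b^q, for b positive and q
-- rational, with the denominator of q cleared:  x ≤ b^(p/m) iff
-- x^m ≤ b^p, and x ≤ b^(-p/m) iff x^m * b^p ≤ 1.

_≤[_^_] : ℕ → ℕ → ℚᵘ → Set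
x ≤[ b ^ mkℚᵘ (+ p)    m-1 ] = x ℕ.^ suc m-1 ℕ.≤ b ℕ.^ p
x ≤[ b ^ mkℚᵘ -[1+ p ] m-1 ] = x ℕ.^ suc m-1 ℕ.* b ℕ.^ suc p ℕ.≤ 1

_∈o[_] : (ℕ → ℚᵘ) → (ℕ → ℚᵘ) → Set
f ∈o[ g ] = ∀ ε → 0ℚᵘ ℚᵘ.< ε →
            ∃[ n₀ ] ∀ n → n₀ ℕ.≤ n → ℚᵘ.∣ f n ∣ ℚᵘ.≤ ε ℚᵘ.* ℚᵘ.∣ g n ∣

-- In the next two definitions `P n s` is read "the n-th object has a
-- circuit of size s".  Since a bound by b^(o(⋯)) only limits the size from
-- above, rational-valued exponents are as general as real-valued ones.

HasSize-2^o[n] : ∀ {a} → (ℕ → ℕ → Set a) → Set a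
HasSize-2^o[n] P =
  ∃[ e ] (e ∈o[ (λ n → + n ℚᵘ./ 1) ] ×
          ∃[ n₀ ] ∀ n → n₀ ℕ.≤ n → ∃[ s ] (P n s × s ≤[ 2 ^ e n ]))

HasSize-N^[1+o[1]] : ∀ {a} → (N : ℕ → ℕ) → (ℕ → ℕ → Set a) → Set a
HasSize-N^[1+o[1]] N P =
  ∃[ δ ] (δ ∈o[ (λ _ → 1ℚᵘ) ] ×
          ∃[ d₀ ] ∀ d → d₀ ℕ.≤ d →
            ∃[ s ] (P d s × s ≤[ N d ^ (1ℚᵘ ℚᵘ.+ δ d) ]))

------------------------------------------------------------------------
-- Boolean functions

innerProduct : ∀ {n} → Vector Bool n → Vector Bool n → Bool
innerProduct x y = foldr _∨_ false (zipWith _∧_ x y)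

toℕ : Bool → ℕ
toℕ b = if b then 1 else 0

innerProductMod2 : ∀ {n} → Vector Bool n → Vector Bool n → Bool
innerProductMod2 x y = sumℕ (λ i → toℕ (x i) ℕ.* toℕ (y i)) % 2 ℕ.≡ᵇ 1

------------------------------------------------------------------------
-- Matrices and circuits over the reals

module OverReals {c ℓ₁ ℓ₂ : Level} (ℝ : RealNumbers c ℓ₁ ℓ₂) where
  open RealNumbers ℝ
  open MonoidSum +-monoid using (sum)

  Matrix : ℕ → ℕ → Set c
  Matrix m n = Fin m → Fin n → Carrier

  _⊗_ : ∀ {m n p q} → Matrix m n → Matrix p q → Matrix (m ℕ.* p) (n ℕ.* q)
  _⊗_ {m} {n} {p} {q} A B i j =
    A (quotient p i) (quotient q j) * B (remainder {m} p i) (remainder {n} q j)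

  _^⊗_ : ∀ {m n} → Matrix m n → (d : ℕ) → Matrix (m ℕ.^ d) (n ℕ.^ d)
  A ^⊗ zero  = λ _ _ → 1#
  A ^⊗ suc d = A ⊗ (A ^⊗ d)

  nnz : ∀ {m n} → Matrix m n → ℕ
  nnz A = sumℕ λ i → sumℕ λ j → if does (A i j ≟ 0#) then 0 else 1

  disjointness : (d : ℕ) → Matrix (2 ℕ.^ d) (2 ℕ.^ d)
  disjointness d = ((1# ∷ 1# ∷ []) ∷ (1# ∷ 0# ∷ []) ∷ []) ^⊗ d

  walshHadamard : (d : ℕ) → Matrix (2 ℕ.^ d) (2 ℕ.^ d)
  walshHadamard d = ((1# ∷ 1# ∷ []) ∷ (1# ∷ - 1# ∷ []) ∷ []) ^⊗ d

  record Depth2Circuit {m n : ℕ} (M : Matrix m n) : Set (c ⊔ ℓ₁) where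
    field
      width    : ℕ
      U        : Matrix m width
      V        : Matrix n width
      computes : ∀ i j → M i j ≈ sum (λ k → U i k * V j k)

    size : ℕ
    size = nnz U ℕ.+ nnz V

  HasDepth2Circuit : ∀ {m n} → Matrix m n → ℕ → Set (c ⊔ ℓ₁)
  HasDepth2Circuit M s = ∃[ C ] Depth2Circuit.size {M = M} C ≡ s

  ⟦_⟧ : Bool → Carrier
  ⟦ b ⟧ = if b then 1# else 0#

  record ETHR (ℓ : ℕ) : Set c where
    field
      weights   : Vector Carrier ℓ
      threshold : Carrier

    eval : Vector Bool ℓ → Bool
    eval z = does (sum (λ i → weights i * ⟦ z i ⟧) ≟ threshold)

  record SUM∘ETHR (ℓ : ℕ) : Set c where
    field
      bottom : ℕ
      gates  : Vector (ETHR ℓ) bottom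
      coeffs : Vector Carrier bottom

    output : Vector Bool ℓ → Carrier
    output z = sum (λ i → coeffs i * ⟦ ETHR.eval (gates i) z ⟧)

    -- The top gate is counted too.
    size : ℕ
    size = suc bottom

  HasSUM∘ETHRCircuit : ∀ {n} → (Vector Bool n → Vector Bool n → Bool) → ℕ → Set (c ⊔ ℓ₁)
  HasSUM∘ETHRCircuit {n} f s =
    ∃[ C ] (SUM∘ETHR.size C ≡ s ×
            (∀ (x y : Vector Bool n) → SUM∘ETHR.output C (x ++ y) ≈ ⟦ f x y ⟧))

{-# OPTIONS --safe #-}

-- Index the rows and columns of M by bit vectors x and y, so that
-- M = 1 + α f(x,y) with f the Boolean function.  On a fixed ETHR gate the
-- input (x,y) contributes a(x) + b(y) to the threshold test, so the 0/1
-- matrix of the gate is block diagonal up to permutations, with constant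
-- blocks: one block for each value of a.  Such a matrix factors through its
-- blocks with at most one nonzero entry in each row of either factor.  Hence
-- a SUM∘ETHR circuit of size 2^o(n) turns into a depth-2 linear circuit of
-- size 2^o(n) · 2N = N^(1+o(1)).

module Submission where

open import Defs
open import Level using (Level; _⊔_)
open import Algebra.Bundles using (CommutativeMonoid; CommutativeRing)
import Algebra.Properties.CommutativeMonoid.Sum as CommutativeMonoidSum
import Algebra.Properties.CommutativeSemigroup as CommutativeSemigroupProperties
import Algebra.Properties.Group as GroupProperties
import Algebra.Properties.Ring as RingProperties
import Algebra.Properties.Semiring.Sum as SemiringSum
open import Data.Bool.Base using (Bool; true; false; not; _∧_; _∨_; if_then_else_)
open import Data.Fin.Base using (Fin; zero; suc; _↑ˡ_; _↑ʳ_; splitAt; finToFun; quotient; remainder)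
import Data.Fin.Properties as Fin
open import Data.Integer.Base as ℤ using (+_; -[1+_]; +<+; +≤+)
import Data.Integer.Properties as ℤ
open import Data.Maybe.Base as Maybe using (Maybe; nothing; just)
open import Data.Nat.Base as ℕ using (ℕ; zero; suc; _^_; pred; z≤n; s≤s)
open import Data.Nat.DivMod using (_%_)
import Data.Nat.Properties as ℕ
open import Data.Nat.Tactic.RingSolver using (solve-∀)
open import Data.Product.Base using (_×_; _,_; ∃-syntax)
open import Data.Rational.Unnormalised.Base as ℚᵘ using (ℚᵘ; mkℚᵘ; 1ℚᵘ; ↥_; ↧ₙ_; *≤*; *<*)
open import Data.Sum.Base using (inj₁; inj₂)
open import Data.Vec.Functional using (Vector; []; _∷_; _++_; map)
open import Data.Vec.Functional.Properties using (lookup-++ˡ; lookup-++ʳ)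
open import Function.Base using (_∘_)
open import Function.Bundles using (mk⇔)
open import Relation.Binary.PropositionalEquality
  using (_≡_; _≗_; refl; sym; trans; cong; cong₂; subst; module ≡-Reasoning)
import Relation.Binary.Reasoning.Setoid as ≈-Reasoning
open import Relation.Nullary.Decidable using (yes; no; does; dec-true; does-⇔)
open import Relation.Nullary.Negation.Core using (¬_; contradiction)

module ∑ℕ = CommutativeMonoidSum ℕ.+-0-commutativeMonoid

-- Asymptotics

^-distrib-* : ∀ m n k → (m ℕ.* n) ^ k ≡ m ^ k ℕ.* n ^ k
^-distrib-* m n zero    = refl
^-distrib-* m n (suc k) = begin
  m ℕ.* n ℕ.* (m ℕ.* n) ^ k        ≡⟨ cong (m ℕ.* n ℕ.*_) (^-distrib-* m n k) ⟩
  m ℕ.* n ℕ.* (m ^ k ℕ.* n ^ k)    ≡⟨ interchange m n (m ^ k) (n ^ k) ⟩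
  m ℕ.* m ^ k ℕ.* (n ℕ.* n ^ k)    ∎
  where
  open ≡-Reasoning
  open CommutativeSemigroupProperties ℕ.*-commutativeSemigroup using (interchange)

≤[^]⇒≤-abs : ∀ {x} b .{{_ : ℕ.NonZero b}} q → x ≤[ b ^ q ] →
             x ^ (↧ₙ q) ℕ.≤ b ^ ℤ.∣ ↥ q ∣
≤[^]⇒≤-abs b (mkℚᵘ (+ p)    m-1) h = h
≤[^]⇒≤-abs {x} b (mkℚᵘ -[1+ p ] m-1) h = begin
  x ^ suc m-1                    ≤⟨ ℕ.m≤m*n _ (b ^ suc p) {{ℕ.m^n≢0 b (suc p)}} ⟩
  x ^ suc m-1 ℕ.* b ^ suc p      ≤⟨ h ⟩
  1                              ≤⟨ ℕ.m^n>0 b (suc p) ⟩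
  b ^ suc p                      ∎
  where open ℕ.≤-Reasoning

-- `_≤[_^_]` reads numerator and denominator off the representation, so equality as rationals would
-- be too weak for substitution.
1+mkℚᵘ : ∀ a b-1 → 1ℚᵘ ℚᵘ.+ mkℚᵘ (+ a) b-1 ≡ mkℚᵘ (+ (suc b-1 ℕ.+ a)) b-1
1+mkℚᵘ a b-1 = cong₂ mkℚᵘ
  (cong₂ ℤ._+_ (ℤ.*-identityˡ (+ suc b-1)) (ℤ.*-identityʳ (+ a)))
  (ℕ.+-identityʳ b-1)

-- (|q| + 1) / d, except that the junk value at d = 0 is |↥ q| + ↧ q.
[∣_∣+1]/_ : ℚᵘ → ℕ → ℚᵘ
[∣ q ∣+1]/ d = mkℚᵘ (+ (ℤ.∣ ↥ q ∣ ℕ.+ ↧ₙ q)) (pred (↧ₙ q ℕ.* d))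

∣q∣≤a/b*d⇒ : ∀ q a b-1 d → ℚᵘ.∣ q ∣ ℚᵘ.≤ mkℚᵘ (+ a) b-1 ℚᵘ.* ℚᵘ.∣ + d ℚᵘ./ 1 ∣ →
            ℤ.∣ ↥ q ∣ ℕ.* suc b-1 ℕ.≤ a ℕ.* d ℕ.* ↧ₙ q
∣q∣≤a/b*d⇒ (mkℚᵘ n m-1) a b-1 d (*≤* h) = ℤ.drop‿+≤+ (begin
  + (p ℕ.* suc b-1)                ≡⟨ cong (λ b → + (p ℕ.* b)) (ℕ.*-identityʳ (suc b-1)) ⟨
  + (p ℕ.* (suc b-1 ℕ.* 1))        ≡⟨ ℤ.pos-* p _ ⟩
  + p ℤ.* + (suc b-1 ℕ.* 1)        ≤⟨ h ⟩
  + a ℤ.* + d ℤ.* + suc m-1        ≡⟨ cong (ℤ._* + suc m-1) (ℤ.pos-* a d) ⟨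
  + (a ℕ.* d) ℤ.* + suc m-1        ≡⟨ ℤ.pos-* (a ℕ.* d) _ ⟨
  + (a ℕ.* d ℕ.* suc m-1)          ∎)
  where
  open ℤ.≤-Reasoning
  p = ℤ.∣ n ∣

-- With ε = a/b, the bounds p/m ≤ (ε/2) d and 1 ≤ (ε/2) d add up to p/m + 1 ≤ ε d.
p*2b≤amd⇒[p+m]b≤amd : ∀ p m a b d → p ℕ.* (b ℕ.+ b) ℕ.≤ a ℕ.* d ℕ.* m → b ℕ.+ b ℕ.≤ a ℕ.* d →
                      (p ℕ.+ m) ℕ.* b ℕ.≤ a ℕ.* (m ℕ.* d)
p*2b≤amd⇒[p+m]b≤amd p m a b d h₁ h₂ = ℕ.*-cancelˡ-≤ 2 (begin
  2 ℕ.* ((p ℕ.+ m) ℕ.* b)                     ≡⟨ distribute p m b ⟩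
  p ℕ.* (b ℕ.+ b) ℕ.+ (b ℕ.+ b) ℕ.* m         ≤⟨ ℕ.+-mono-≤ h₁ (ℕ.*-monoˡ-≤ m h₂) ⟩
  a ℕ.* d ℕ.* m ℕ.+ a ℕ.* d ℕ.* m             ≡⟨ collect a d m ⟩
  2 ℕ.* (a ℕ.* (m ℕ.* d))                     ∎)
  where
  open ℕ.≤-Reasoning
  distribute : ∀ p m b → 2 ℕ.* ((p ℕ.+ m) ℕ.* b) ≡ p ℕ.* (b ℕ.+ b) ℕ.+ (b ℕ.+ b) ℕ.* m
  distribute = solve-∀
  collect : ∀ a d m → a ℕ.* d ℕ.* m ℕ.+ a ℕ.* d ℕ.* m ≡ 2 ℕ.* (a ℕ.* (m ℕ.* d))
  collect = solve-∀

[∣∣+1]/-∈o : ∀ e → e ∈o[ (λ n → + n ℚᵘ./ 1) ] → (λ d → [∣ e d ∣+1]/ d) ∈o[ (λ _ → 1ℚᵘ) ]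
[∣∣+1]/-∈o e e∈o (mkℚᵘ (+ zero)  b-1) (*<* (+<+ ()))
[∣∣+1]/-∈o e e∈o (mkℚᵘ -[1+ _ ]  b-1) (*<* ())
[∣∣+1]/-∈o e e∈o (mkℚᵘ (+ suc a) b-1) _
  -- The denominator is 2b, stored as 2b - 1: half of ε is spent on `e`, half on the added 1.
  with n₀ , ∣e∣≤ ← e∈o (mkℚᵘ (+ suc a) (b-1 ℕ.+ suc b-1)) (*<* (+<+ (s≤s z≤n)))
  -- Beyond 2b the added 1 is at most (ε/2) d, because the numerator of ε is at least 1; also d = 0
  -- is excluded.
  = n₀ ℕ.+ 2b , bound
  where
  b = suc b-1
  2b = b ℕ.+ b
  bound : ∀ d → n₀ ℕ.+ 2b ℕ.≤ d →
          ℚᵘ.∣ [∣ e d ∣+1]/ d ∣ ℚᵘ.≤ mkℚᵘ (+ suc a) b-1 ℚᵘ.* ℚᵘ.∣ 1ℚᵘ ∣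
  bound zero n≤d = contradiction (ℕ.≤-trans (ℕ.m≤n+m 2b n₀) n≤d) λ ()
  bound d@(suc _) n≤d = *≤* (begin
    + (p ℕ.+ m) ℤ.* + (b ℕ.* 1)             ≡⟨ ℤ.pos-* (p ℕ.+ m) _ ⟨
    + ((p ℕ.+ m) ℕ.* (b ℕ.* 1))             ≡⟨ cong (λ b → + ((p ℕ.+ m) ℕ.* b)) (ℕ.*-identityʳ b) ⟩
    + ((p ℕ.+ m) ℕ.* b)                     ≤⟨ +≤+ (p*2b≤amd⇒[p+m]b≤amd p m (suc a) b d
      (∣q∣≤a/b*d⇒ (e d) (suc a) _ d (∣e∣≤ d (ℕ.m+n≤o⇒m≤o n₀ n≤d)))
      (ℕ.≤-trans (ℕ.m+n≤o⇒n≤o n₀ n≤d) (ℕ.m≤n*m d (suc a)))) ⟩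
    + (suc a ℕ.* (m ℕ.* d))                 ≡⟨ ℤ.pos-* (suc a) _ ⟩
    + suc a ℤ.* + (m ℕ.* d)                 ≡⟨ cong (ℤ._* + (m ℕ.* d)) (ℤ.*-identityʳ (+ suc a)) ⟨
    + suc a ℤ.* + 1 ℤ.* + (m ℕ.* d)         ∎)
    where
    open ℤ.≤-Reasoning
    p = ℤ.∣ ↥ e d ∣
    m = ↧ₙ (e d)

-- With N = 2^d and s ≤ 2^(p/m), t ≤ s · 2N ≤ 2^(d + p/m + 1) = N^(1 + (p/m + 1)/d); both sides are
-- raised to the power m d to stay in ℕ.
^-bound : ∀ p m d s {t} → t ℕ.≤ s ℕ.* (2 ^ d ℕ.+ 2 ^ d) → s ^ m ℕ.≤ 2 ^ p →
          t ^ (m ℕ.* d) ℕ.≤ (2 ^ d) ^ (m ℕ.* d ℕ.+ (p ℕ.+ m))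
^-bound p m d s {t} t≤ s^m≤2^p = begin
  t ^ (m ℕ.* d)                                  ≤⟨ ℕ.^-monoˡ-≤ (m ℕ.* d) t≤ ⟩
  (s ℕ.* (2 ^ d ℕ.+ 2 ^ d)) ^ (m ℕ.* d)          ≡⟨ ℕ.^-*-assoc (s ℕ.* (2 ^ d ℕ.+ 2 ^ d)) m d ⟨
  ((s ℕ.* (2 ^ d ℕ.+ 2 ^ d)) ^ m) ^ d            ≡⟨ cong (λ x → ((s ℕ.* (2 ^ d ℕ.+ x)) ^ m) ^ d) (ℕ.+-identityʳ (2 ^ d)) ⟨
  ((s ℕ.* 2 ^ suc d) ^ m) ^ d                    ≡⟨ cong (_^ d) (^-distrib-* s (2 ^ suc d) m) ⟩
  (s ^ m ℕ.* (2 ^ suc d) ^ m) ^ d                ≤⟨ ℕ.^-monoˡ-≤ d (ℕ.*-monoˡ-≤ ((2 ^ suc d) ^ m) s^m≤2^p) ⟩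
  (2 ^ p ℕ.* (2 ^ suc d) ^ m) ^ d                ≡⟨ cong (λ x → (2 ^ p ℕ.* x) ^ d) (ℕ.^-*-assoc 2 (suc d) m) ⟩
  (2 ^ p ℕ.* 2 ^ (suc d ℕ.* m)) ^ d              ≡⟨ cong (_^ d) (ℕ.^-distribˡ-+-* 2 p (suc d ℕ.* m)) ⟨
  (2 ^ (p ℕ.+ suc d ℕ.* m)) ^ d                  ≡⟨ ℕ.^-*-assoc 2 (p ℕ.+ suc d ℕ.* m) d ⟩
  2 ^ ((p ℕ.+ suc d ℕ.* m) ℕ.* d)                ≡⟨ cong (2 ^_) (rearrange p d m) ⟩
  2 ^ (d ℕ.* (m ℕ.* d ℕ.+ (p ℕ.+ m)))            ≡⟨ ℕ.^-*-assoc 2 d (m ℕ.* d ℕ.+ (p ℕ.+ m)) ⟨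
  (2 ^ d) ^ (m ℕ.* d ℕ.+ (p ℕ.+ m))              ∎
  where
  open ℕ.≤-Reasoning
  rearrange : ∀ p d m → (p ℕ.+ (1 ℕ.+ d) ℕ.* m) ℕ.* d ≡ d ℕ.* (m ℕ.* d ℕ.+ (p ℕ.+ m))
  rearrange = solve-∀

2^o[n]⇒N^[1+o[1]] : ∀ {a b} {P : ℕ → ℕ → Set a} {Q : ℕ → ℕ → Set b} →
  (∀ d {s} → P d s → ∃[ t ] (Q d t × t ℕ.≤ s ℕ.* (2 ^ d ℕ.+ 2 ^ d))) →
  HasSize-2^o[n] P → HasSize-N^[1+o[1]] (2 ^_) Q
2^o[n]⇒N^[1+o[1]] {Q = Q} P⇒Q (e , e∈o , n₀ , hasP) =
  -- In the numerator |e d| pays for the circuit size and 1 for the factor 2 in 2N. Starting at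
  -- `suc n₀` avoids the junk value at d = 0.
  (λ d → [∣ e d ∣+1]/ d) , [∣∣+1]/-∈o e e∈o , suc n₀ , hasQ
  where
  hasQ : ∀ d → suc n₀ ℕ.≤ d → ∃[ t ] (Q d t × t ≤[ (2 ^ d) ^ (1ℚᵘ ℚᵘ.+ [∣ e d ∣+1]/ d) ])
  hasQ d@(suc _) n₀<d
    with s , Ps , s≤ ← hasP d (ℕ.<⇒≤ n₀<d)
    with t , Qt , t≤ ← P⇒Q d Ps
    = t , Qt , subst (t ≤[ (2 ^ d) ^_]) (sym (1+mkℚᵘ (ℤ.∣ ↥ e d ∣ ℕ.+ ↧ₙ (e d)) _))
               (^-bound ℤ.∣ ↥ e d ∣ (↧ₙ (e d)) d s t≤ (≤[^]⇒≤-abs 2 (e d) s≤))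

-- Finite sums and searches

module _ {c ℓ} (M : CommutativeMonoid c ℓ) where
  private module M = CommutativeMonoid M
  open CommutativeMonoidSum M using (sum)

  sum-splitAt : ∀ m {n} (t : Vector M.Carrier (m ℕ.+ n)) →
                sum t M.≈ sum (λ i → t (i ↑ˡ n)) M.∙ sum (λ i → t (m ↑ʳ i))
  sum-splitAt zero    t = M.sym (M.identityˡ _)
  sum-splitAt (suc m) t = M.trans (M.∙-congˡ (sum-splitAt m (t ∘ suc))) (M.sym (M.assoc _ _ _))

sumℕ-≤ : ∀ {n} b (t : Vector ℕ n) → (∀ i → t i ℕ.≤ b) → ∑ℕ.sum t ℕ.≤ n ℕ.* b
sumℕ-≤ {zero}  b t t≤b = z≤n
sumℕ-≤ {suc n} b t t≤b = ℕ.+-mono-≤ (t≤b zero) (sumℕ-≤ b (t ∘ suc) (t≤b ∘ suc))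

first : ∀ {n} → Vector Bool n → Maybe (Fin n)
first {zero}  p = nothing
first {suc n} p = if p zero then just zero else Maybe.map suc (first (p ∘ suc))

-- This makes the representative an invariant of the block: equal rows choose the same column.
first-cong : ∀ {n} {p q : Vector Bool n} → p ≗ q → first p ≡ first q
first-cong {zero}          p≗q = refl
first-cong {suc n} {p} {q} p≗q rewrite p≗q zero | first-cong (p≗q ∘ suc) = refl

first-sound : ∀ {n} (p : Vector Bool n) {i} → first p ≡ just i → p i ≡ true
first-sound {suc n} p eq with p zero in p₀ | first (p ∘ suc) in eq′
first-sound {suc n} p refl | true  | _      = p₀
first-sound {suc n} p refl | false | just i = first-sound (p ∘ suc) eq′

first-complete : ∀ {n} (p : Vector Bool n) i → p i ≡ true → ∃[ j ] first p ≡ just j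
first-complete {suc n} p i       pᵢ with p zero in p₀
first-complete {suc n} p i       pᵢ | true = zero , refl
first-complete {suc n} p zero    pᵢ | false = contradiction (trans (sym p₀) pᵢ) λ ()
first-complete {suc n} p (suc i) pᵢ | false
  with j , eq ← first-complete (p ∘ suc) i pᵢ = suc j , cong (Maybe.map suc) eq

-- Boolean matrices whose rows are pairwise equal or disjoint
Difunctional : ∀ {m n} → (Fin m → Fin n → Bool) → Set
Difunctional B = ∀ {x x′ y} → B x y ≡ true → B x′ y ≡ true → B x ≗ B x′

module _ {m n} (B : Fin m → Fin n → Bool) where

  -- A block is represented by its first column.
  rowRep : Fin m → Maybe (Fin n)
  rowRep x = first (B x)

  -- The representative is read off the first row meeting the column; difunctionality makes the
  -- choice of row immaterial.
  colRep : Fin n → Maybe (Fin n)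
  colRep y = first (λ x → B x y) Maybe.>>= rowRep

  module _ (difunctional : Difunctional B) where

    -- Row x and the row consulted by `colRep` share column y, so they are equal and have the same
    -- first column.
    true⇒colRep : ∀ {x y j} → rowRep x ≡ just j → B x y ≡ true → colRep y ≡ just j
    true⇒colRep {x} {y} x↦j Bxy
      with x′ , y↦x′ ← first-complete (λ x → B x y) x Bxy
      rewrite y↦x′ =
      trans (first-cong (difunctional (first-sound (λ x → B x y) y↦x′) Bxy)) x↦j

    -- Row x and the row x′ consulted by `colRep` share column j, so they are equal, and x′ contains
    -- y.
    colRep⇒true : ∀ {x y j} → rowRep x ≡ just j → colRep y ≡ just j → B x y ≡ true
    colRep⇒true {x} {y} x↦j y↦j with first (λ x → B x y) in y↦x′
    ... | just x′ =
      trans (difunctional (first-sound (B x) x↦j) (first-sound (B x′) y↦j) y)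
            (first-sound (λ x → B x y) y↦x′)

-- Depth-2 circuits

module Circuits {c ℓ₁ ℓ₂ : Level} (ℝ : RealNumbers c ℓ₁ ℓ₂) where
  open RealNumbers ℝ
  open OverReals ℝ
  open CommutativeRing commutativeRing
    using (semiring; ring; setoid; +-commutativeMonoid; +-group; +-congˡ; +-congʳ; +-cong;
           *-congˡ; *-identityˡ; *-identityʳ; zeroˡ; zeroʳ; +-identityˡ;
           +-identityʳ; *-assoc; -‿inverseʳ)
    renaming (refl to ≈-refl; sym to ≈-sym; trans to ≈-trans; reflexive to ≈-reflexive)
  open SemiringSum semiring using (sum; sum-cong-≋; sum-replicate-zero; ∑-distrib-+; *-distribˡ-sum)
  open RingProperties ring using (-1*x≈-x; -‿involutive)

  -- Vectors with at most one nonzero entry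

  single : ∀ {n} → Maybe (Fin n) → Carrier → Vector Carrier n
  single nothing  a j = 0#
  single (just i) a j = if does (i Fin.≟ j) then a else 0#

  single-≡ : ∀ {n} (i : Fin n) a → single (just i) a i ≡ a
  single-≡ i a = cong (if_then a else 0#) (dec-true (i Fin.≟ i) refl)

  single-≢ : ∀ {n} (i : Maybe (Fin n)) a j → ¬ i ≡ just j → single i a j ≡ 0#
  single-≢ nothing  a j i≢j = refl
  single-≢ (just i) a j i≢j with i Fin.≟ j
  ... | yes i≡j = contradiction (cong just i≡j) i≢j
  ... | no  _   = refl

  sum-zeroˡ : ∀ {n} (v : Vector Carrier n) → sum (λ j → 0# * v j) ≈ 0#
  sum-zeroˡ {n} v = ≈-trans (sum-cong-≋ (λ j → zeroˡ (v j))) (sum-replicate-zero n)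

  sum-single : ∀ {n} i a (v : Vector Carrier n) → sum (λ j → single (just i) a j * v j) ≈ a * v i
  sum-single zero    a v = ≈-trans (+-congˡ (sum-zeroˡ (v ∘ suc))) (+-identityʳ _)
  sum-single (suc i) a v =
    ≈-trans (+-cong (zeroˡ (v zero)) (sum-single i a (v ∘ suc))) (+-identityˡ _)

  weight : Carrier → ℕ
  weight a = if does (a ≟ 0#) then 0 else 1

  weight-0# : weight 0# ≡ 0
  weight-0# = cong (if_then 0 else 1) (dec-true (0# ≟ 0#) ≈-refl)

  weight≤1 : ∀ a → weight a ℕ.≤ 1
  weight≤1 a with does (a ≟ 0#)
  ... | true  = z≤n
  ... | false = ℕ.≤-refl

  weight-zeros : ∀ n → ∑ℕ.sum {n} (λ _ → weight 0#) ≡ 0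
  weight-zeros n = trans (∑ℕ.sum-cong-≗ {n} (λ _ → weight-0#)) (∑ℕ.sum-replicate-zero n)

  weight-single : ∀ {n} (i : Maybe (Fin n)) a → ∑ℕ.sum (λ j → weight (single i a j)) ℕ.≤ 1
  weight-single {n} nothing a = ℕ.≤-trans (ℕ.≤-reflexive (weight-zeros n)) z≤n
  weight-single {suc n} (just zero) a = ℕ.+-mono-≤ (weight≤1 a) (ℕ.≤-reflexive (weight-zeros n))
  weight-single (just (suc i)) a =
    ℕ.+-mono-≤ (ℕ.≤-reflexive weight-0#) (weight-single (just i) a)

  -- Building depth-2 circuits

  _∣∣_ : ∀ {m n k} → Matrix m n → Matrix m k → Matrix m (n ℕ.+ k)
  (A ∣∣ B) i = A i ++ B i

  nnz-∣∣ : ∀ {m n k} (A : Matrix m n) (B : Matrix m k) → nnz (A ∣∣ B) ≡ nnz A ℕ.+ nnz B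
  nnz-∣∣ {m} {n} {k} A B = begin
    nnz (A ∣∣ B)
      ≡⟨ ∑ℕ.sum-cong-≗ (λ i → sum-splitAt ℕ.+-0-commutativeMonoid n (λ j → weight ((A ∣∣ B) i j))) ⟩
    ∑ℕ.sum (λ i → ∑ℕ.sum (λ j → weight ((A ∣∣ B) i (j ↑ˡ k))) ℕ.+ ∑ℕ.sum (λ j → weight ((A ∣∣ B) i (n ↑ʳ j))))
      ≡⟨ ∑ℕ.sum-cong-≗ (λ i → cong₂ ℕ._+_
           (∑ℕ.sum-cong-≗ (λ j → cong weight (lookup-++ˡ (A i) (B i) j)))
           (∑ℕ.sum-cong-≗ (λ j → cong weight (lookup-++ʳ (A i) (B i) j)))) ⟩
    ∑ℕ.sum (λ i → ∑ℕ.sum (λ j → weight (A i j)) ℕ.+ ∑ℕ.sum (λ j → weight (B i j)))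
      ≡⟨ ∑ℕ.∑-distrib-+ (λ i → ∑ℕ.sum (λ j → weight (A i j))) _ ⟩
    nnz A ℕ.+ nnz B ∎
    where open ≡-Reasoning

  -- Exact sizes depend on which coefficients vanish; upper bounds compose without tracking this.
  Depth2≤ : ∀ {m n} → Matrix m n → ℕ → Set (c ⊔ ℓ₁)
  Depth2≤ M s = ∃[ C ] Depth2Circuit.size {M = M} C ℕ.≤ s

  ≤⇒HasDepth2Circuit : ∀ {m n s} {M : Matrix m n} → Depth2≤ M s → ∃[ t ] (HasDepth2Circuit M t × t ℕ.≤ s)
  ≤⇒HasDepth2Circuit (C , size≤s) = _ , (C , refl) , size≤s

  depth2-resp : ∀ {m n s} {M M′ : Matrix m n} → (∀ i j → M′ i j ≈ M i j) → Depth2≤ M s → Depth2≤ M′ s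
  depth2-resp M′≈M (C , size≤s) =
    record { U = U ; V = V ; computes = λ i j → ≈-trans (M′≈M i j) (computes i j) } , size≤s
    where open Depth2Circuit C using (U; V; computes)

  depth2-zero : ∀ {m n} → Depth2≤ {m} {n} (λ _ _ → 0#) 0
  depth2-zero {m} {n} =
    record { width = 0 ; U = λ _ () ; V = λ _ () ; computes = λ _ _ → ≈-refl } ,
    ℕ.≤-reflexive (cong₂ ℕ._+_ (∑ℕ.sum-replicate-zero m) (∑ℕ.sum-replicate-zero n))

  -- Juxtaposing the factors works because [U U′][V V′]ᵀ = UVᵀ + U′V′ᵀ.
  depth2-+ : ∀ {m n s t} {M M′ : Matrix m n} → Depth2≤ M s → Depth2≤ M′ t →
             Depth2≤ (λ i j → M i j + M′ i j) (s ℕ.+ t)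
  depth2-+ {s = s} {t} {M} {M′} (C , C≤s) (C′ , C′≤t) =
    record { U = C.U ∣∣ C′.U ; V = C.V ∣∣ C′.V ; computes = computes } , size≤
    where
    module C  = Depth2Circuit C
    module C′ = Depth2Circuit C′
    W = λ i j k → (C.U ∣∣ C′.U) i k * (C.V ∣∣ C′.V) j k
    computes : ∀ i j → M i j + M′ i j ≈ sum (W i j)
    computes i j = begin
      M i j + M′ i j
        ≈⟨ +-cong (C.computes i j) (C′.computes i j) ⟩
      sum (λ k → C.U i k * C.V j k) + sum (λ k → C′.U i k * C′.V j k)
        ≈⟨ +-cong
             (sum-cong-≋ (λ k → ≈-reflexive
               (cong₂ _*_ (lookup-++ˡ (C.U i) (C′.U i) k) (lookup-++ˡ (C.V j) (C′.V j) k))))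
             (sum-cong-≋ (λ k → ≈-reflexive
               (cong₂ _*_ (lookup-++ʳ (C.U i) (C′.U i) k) (lookup-++ʳ (C.V j) (C′.V j) k)))) ⟨
      sum (λ k → W i j (k ↑ˡ C′.width)) + sum (λ k → W i j (C.width ↑ʳ k))
        ≈⟨ sum-splitAt +-commutativeMonoid C.width (W i j) ⟨
      sum (W i j) ∎
      where open ≈-Reasoning setoid
    size≤ : nnz (C.U ∣∣ C′.U) ℕ.+ nnz (C.V ∣∣ C′.V) ℕ.≤ s ℕ.+ t
    size≤ = begin
      nnz (C.U ∣∣ C′.U) ℕ.+ nnz (C.V ∣∣ C′.V)
        ≡⟨ cong₂ ℕ._+_ (nnz-∣∣ C.U C′.U) (nnz-∣∣ C.V C′.V) ⟩
      (nnz C.U ℕ.+ nnz C′.U) ℕ.+ (nnz C.V ℕ.+ nnz C′.V)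
        ≡⟨ interchange (nnz C.U) (nnz C′.U) (nnz C.V) (nnz C′.V) ⟩
      C.size ℕ.+ C′.size
        ≤⟨ ℕ.+-mono-≤ C≤s C′≤t ⟩
      s ℕ.+ t ∎
      where
      open ℕ.≤-Reasoning
      open CommutativeSemigroupProperties ℕ.+-commutativeSemigroup using (interchange)

  -- The middle layer is indexed by columns, used as names of blocks. Row x of `U` has `a` at the
  -- name of its block, row y of `V` has 1 at the name of its own, and the names meet exactly when
  -- `B x y` holds.
  depth2-difunctional : ∀ {m n} a (B : Fin m → Fin n → Bool) → Difunctional B →
                        Depth2≤ (λ x y → a * ⟦ B x y ⟧) (m ℕ.+ n)
  depth2-difunctional {m} {n} a B difunctional =
    record { U = U ; V = V ; computes = computes } ,
    (begin
      nnz U ℕ.+ nnz V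
        ≤⟨ ℕ.+-mono-≤ (sumℕ-≤ 1 _ (λ x → weight-single (rowRep B x) a))
                      (sumℕ-≤ 1 _ (λ y → weight-single (colRep B y) 1#)) ⟩
      m ℕ.* 1 ℕ.+ n ℕ.* 1
        ≡⟨ cong₂ ℕ._+_ (ℕ.*-identityʳ m) (ℕ.*-identityʳ n) ⟩
      m ℕ.+ n ∎)
    where
    open ℕ.≤-Reasoning
    U : Matrix m n
    U x = single (rowRep B x) a
    V : Matrix n n
    V y = single (colRep B y) 1#
    V-col : ∀ {x y j} → rowRep B x ≡ just j → V y j ≡ ⟦ B x y ⟧
    V-col {x} {y} {j} x↦j with B x y in Bxy
    ... | true rewrite true⇒colRep B difunctional x↦j Bxy = single-≡ j 1#
    ... | false = single-≢ (colRep B y) 1# j λ y↦j →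
      contradiction (trans (sym Bxy) (colRep⇒true B difunctional x↦j y↦j)) λ ()
    computes : ∀ x y → a * ⟦ B x y ⟧ ≈ sum (λ k → U x k * V y k)
    computes x y with rowRep B x in x↦j
    ... | just j  = ≈-trans (*-congˡ (≈-reflexive (sym (V-col x↦j)))) (≈-sym (sum-single j a (V y)))
    -- A row without representative is empty, so both sides vanish and `true` cannot occur.
    ... | nothing with B x y in Bxy
    ...   | false = ≈-trans (zeroʳ a) (≈-sym (sum-zeroˡ (V y)))
    ...   | true with _ , eq ← first-complete (B x) y Bxy =
      contradiction (trans (sym eq) x↦j) λ ()

  depth2-sum : ∀ {m n} g (a : Vector Carrier g) (B : Fin g → Fin m → Fin n → Bool) →
               (∀ k → Difunctional (B k)) →
               Depth2≤ (λ x y → sum (λ k → a k * ⟦ B k x y ⟧)) (g ℕ.* (m ℕ.+ n))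
  depth2-sum zero    a B difunctional = depth2-zero
  depth2-sum (suc g) a B difunctional =
    depth2-+ (depth2-difunctional (a zero) (B zero) (difunctional zero))
             (depth2-sum g (a ∘ suc) (B ∘ suc) (difunctional ∘ suc))

  -- Exact threshold gates

  module _ {n} (G : ETHR (n ℕ.+ n)) where
    open ETHR G

    weightedSum : Vector Bool (n ℕ.+ n) → Carrier
    weightedSum z = sum (λ i → weights i * ⟦ z i ⟧)

    -- Both sides equal a(x) + a(x′) + b(y) + b(y′), where a and b are the contributions of the two
    -- halves of the input. Termwise, the first half only commutes and the second half is unchanged.
    weightedSum-exchange : ∀ (x x′ y y′ : Vector Bool n) →
      weightedSum (x ++ y) + weightedSum (x′ ++ y′) ≈ weightedSum (x′ ++ y) + weightedSum (x ++ y′)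
    weightedSum-exchange x x′ y y′ = begin
      weightedSum (x ++ y) + weightedSum (x′ ++ y′)            ≈⟨ ∑-distrib-+ (term x y) _ ⟨
      sum (λ i → term x y i + term x′ y′ i)                    ≈⟨ sum-cong-≋ pointwise ⟩
      sum (λ i → term x′ y i + term x y′ i)                    ≈⟨ ∑-distrib-+ (term x′ y) _ ⟩
      weightedSum (x′ ++ y) + weightedSum (x ++ y′)            ∎
      where
      open ≈-Reasoning setoid
      term : (x y : Vector Bool n) → Vector Carrier (n ℕ.+ n)
      term x y i = weights i * ⟦ (x ++ y) i ⟧
      pointwise : ∀ i → term x y i + term x′ y′ i ≈ term x′ y i + term x y′ i
      pointwise i with splitAt n i
      ... | inj₁ j = CommutativeMonoid.comm +-commutativeMonoid _ _
      ... | inj₂ j = ≈-refl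

    eval⇒≈ : ∀ {z} → eval z ≡ true → weightedSum z ≈ threshold
    eval⇒≈ {z} ev with weightedSum z ≟ threshold
    ... | yes w≈t = w≈t

    -- If the gate fires on both inputs, both sums equal the threshold; cancelling it in the
    -- exchange identity shows that x and x′ contribute equally next to any y′.
    eval-difunctional : ∀ {x x′ y : Vector Bool n} → eval (x ++ y) ≡ true → eval (x′ ++ y) ≡ true →
                        ∀ y′ → eval (x ++ y′) ≡ eval (x′ ++ y′)
    eval-difunctional {x} {x′} {y} e e′ y′ =
      does-⇔ (mk⇔ (≈-trans (≈-sym same)) (≈-trans same)) (_ ≟ threshold) (_ ≟ threshold)
      where
      same : weightedSum (x ++ y′) ≈ weightedSum (x′ ++ y′)
      same = ≈-sym (GroupProperties.∙-cancelˡ +-group threshold _ _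
        (≈-trans (+-congʳ (≈-sym (eval⇒≈ e)))
        (≈-trans (weightedSum-exchange x x′ y y′) (+-congʳ (eval⇒≈ e′)))))

  -- From threshold circuits to linear circuits

  bit : Fin 2 → Bool
  bit zero    = false
  bit (suc _) = true

  -- `finToFun` peels off digits by `quotient` and `remainder`, just as `_^⊗_` indexes Kronecker
  -- powers, so inductions on d unfold both together.
  bits : ∀ d → Fin (2 ^ d) → Vector Bool d
  bits d i = map bit (finToFun {2} {d} i)

  -- Substituting the circuit for f makes M a combination of the all-ones matrix and the gate
  -- matrices, all difunctional. The parameter α covers both theorems: -1 for disjointness, -2 for
  -- Walsh-Hadamard.
  depth2-SUM∘ETHR : ∀ d {s α} {M : Matrix (2 ^ d) (2 ^ d)} (f : Vector Bool d → Vector Bool d → Bool) →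
    (∀ i j → M i j ≈ 1# + α * ⟦ f (bits d i) (bits d j) ⟧) →
    HasSUM∘ETHRCircuit f s →
    ∃[ t ] (HasDepth2Circuit M t × t ℕ.≤ s ℕ.* (2 ^ d ℕ.+ 2 ^ d))
  depth2-SUM∘ETHR d {α = α} {M} f M≈ (C , refl , output≈f) =
    ≤⇒HasDepth2Circuit (depth2-resp M≈sum (depth2-sum _ a B difunctional))
    where
    open SUM∘ETHR C
    open ≈-Reasoning setoid
    -- The all-ones matrix takes the slot of the top gate, so the number of summands is exactly the
    -- circuit size s.
    a : Vector Carrier (suc bottom)
    a = 1# ∷ λ k → α * coeffs k
    B : Fin (suc bottom) → Fin (2 ^ d) → Fin (2 ^ d) → Bool
    B = (λ _ _ → true) ∷ λ k i j → ETHR.eval (gates k) (bits d i ++ bits d j)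
    difunctional : ∀ k → Difunctional (B k)
    difunctional zero    _ _ _ = refl
    difunctional (suc k) e e′ j′ = eval-difunctional (gates k) e e′ (bits d j′)
    M≈sum : ∀ i j → M i j ≈ sum (λ k → a k * ⟦ B k i j ⟧)
    M≈sum i j = begin
      M i j
        ≈⟨ M≈ i j ⟩
      1# + α * ⟦ f (bits d i) (bits d j) ⟧
        ≈⟨ +-congˡ (*-congˡ (output≈f (bits d i) (bits d j))) ⟨
      1# + α * sum (λ k → coeffs k * ⟦ B (suc k) i j ⟧)
        ≈⟨ +-cong (≈-sym (*-identityʳ 1#)) (*-distribˡ-sum {bottom} α _) ⟩
      1# * 1# + sum (λ k → α * (coeffs k * ⟦ B (suc k) i j ⟧))
        ≈⟨ +-congˡ (sum-cong-≋ (λ k → *-assoc α (coeffs k) ⟦ B (suc k) i j ⟧)) ⟨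
      sum (λ k → a k * ⟦ B k i j ⟧) ∎

  -- The disjointness matrix

  ⟦not⟧ : ∀ b → ⟦ not b ⟧ ≈ 1# + (- 1#) * ⟦ b ⟧
  ⟦not⟧ true  = ≈-sym (≈-trans (+-congˡ (*-identityʳ (- 1#))) (-‿inverseʳ 1#))
  ⟦not⟧ false = ≈-sym (≈-trans (+-congˡ (zeroʳ (- 1#))) (+-identityʳ 1#))

  -- Each Kronecker factor is the negated conjunction of one pair of bits, and by De Morgan the
  -- product of the negations negates the disjunction.
  disjointness≈⟦not⟧ : ∀ d (i j : Fin (2 ^ d)) →
    disjointness d i j ≈ ⟦ not (innerProduct (bits d i) (bits d j)) ⟧
  disjointness≈⟦not⟧ zero    i j = ≈-refl
  disjointness≈⟦not⟧ (suc d) i j =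
    ≈-trans (*-congˡ (disjointness≈⟦not⟧ d (remainder {2} (2 ^ d) i) (remainder {2} (2 ^ d) j)))
            (step (quotient (2 ^ d) i) (quotient (2 ^ d) j) _)
    where
    step : ∀ p q b → ((1# ∷ 1# ∷ []) ∷ (1# ∷ 0# ∷ []) ∷ []) p q * ⟦ not b ⟧ ≈
                     ⟦ not ((bit p ∧ bit q) ∨ b) ⟧
    step zero       zero       b = *-identityˡ _
    step zero       (suc zero) b = *-identityˡ _
    step (suc zero) zero       b = *-identityˡ _
    step (suc zero) (suc zero) b = zeroˡ _

  disjointness-affine : ∀ d (i j : Fin (2 ^ d)) →
    disjointness d i j ≈ 1# + (- 1#) * ⟦ innerProduct (bits d i) (bits d j) ⟧
  disjointness-affine d i j = ≈-trans (disjointness≈⟦not⟧ d i j) (⟦not⟧ (innerProduct (bits d i) (bits d j)))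

  -- The Walsh-Hadamard matrix

  odd : ℕ → Bool
  odd n = n % 2 ℕ.≡ᵇ 1

  odd-suc : ∀ n → odd (suc n) ≡ not (odd n)
  odd-suc zero          = refl
  odd-suc (suc zero)    = refl
  odd-suc (suc (suc n)) = odd-suc n

  sign : Bool → Carrier
  sign b = if b then - 1# else 1#

  sign-not : ∀ b → - 1# * sign b ≈ sign (not b)
  sign-not true  = ≈-trans (-1*x≈-x (- 1#)) (-‿involutive 1#)
  sign-not false = *-identityʳ (- 1#)

  -- This is (-1)^b = 1 - 2b, with -2 written as a sum.
  sign-affine : ∀ b → sign b ≈ 1# + (- 1# + - 1#) * ⟦ b ⟧
  sign-affine false = ≈-sym (≈-trans (+-congˡ (zeroʳ _)) (+-identityʳ 1#))
  sign-affine true  = begin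
    - 1#                              ≈⟨ +-identityˡ (- 1#) ⟨
    0# + - 1#                         ≈⟨ +-congʳ (-‿inverseʳ 1#) ⟨
    1# + - 1# + - 1#                  ≈⟨ CommutativeMonoid.assoc +-commutativeMonoid 1# (- 1#) (- 1#) ⟩
    1# + (- 1# + - 1#)                ≈⟨ +-congˡ (*-identityʳ _) ⟨
    1# + (- 1# + - 1#) * 1#           ∎
    where open ≈-Reasoning setoid

  -- Each Kronecker factor contributes (-1)^(xᵢyᵢ), so the exponents add up to the inner product, of
  -- which only the parity matters.
  walshHadamard≈sign : ∀ d (i j : Fin (2 ^ d)) →
    walshHadamard d i j ≈ sign (innerProductMod2 (bits d i) (bits d j))
  walshHadamard≈sign zero    i j = ≈-refl
  walshHadamard≈sign (suc d) i j =
    ≈-trans (*-congˡ (walshHadamard≈sign d (remainder {2} (2 ^ d) i) (remainder {2} (2 ^ d) j)))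
            (step (quotient (2 ^ d) i) (quotient (2 ^ d) j) _)
    where
    step : ∀ p q n → ((1# ∷ 1# ∷ []) ∷ (1# ∷ - 1# ∷ []) ∷ []) p q * sign (odd n) ≈
                     sign (odd (toℕ (bit p) ℕ.* toℕ (bit q) ℕ.+ n))
    step zero       zero       n = *-identityˡ _
    step zero       (suc zero) n = *-identityˡ _
    step (suc zero) zero       n = *-identityˡ _
    step (suc zero) (suc zero) n =
      ≈-trans (sign-not (odd n)) (≈-reflexive (cong sign (sym (odd-suc n))))

  walshHadamard-affine : ∀ d (i j : Fin (2 ^ d)) →
    walshHadamard d i j ≈ 1# + (- 1# + - 1#) * ⟦ innerProductMod2 (bits d i) (bits d j) ⟧
  walshHadamard-affine d i j =
    ≈-trans (walshHadamard≈sign d i j) (sign-affine (innerProductMod2 (bits d i) (bits d j)))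

theorem1p6 : ∀ {c ℓ₁ ℓ₂ : Level} (ℝ : RealNumbers c ℓ₁ ℓ₂) → let open OverReals ℝ in
    ( ¬ HasSize-N^[1+o[1]] (λ d → 2 ^ d) (λ d → HasDepth2Circuit (disjointness d))
    → ¬ HasSize-2^o[n] (λ n → HasSUM∘ETHRCircuit (innerProduct {n})) )
    × ( ¬ HasSize-N^[1+o[1]] (λ d → 2 ^ d) (λ d → HasDepth2Circuit (walshHadamard d))
    → ¬ HasSize-2^o[n] (λ n → HasSUM∘ETHRCircuit (innerProductMod2 {n})) )
theorem1p6 ℝ =
  (λ ¬D P → ¬D (2^o[n]⇒N^[1+o[1]] (λ d → depth2-SUM∘ETHR d innerProduct (disjointness-affine d)) P)) ,
  (λ ¬D P → ¬D (2^o[n]⇒N^[1+o[1]] (λ d → depth2-SUM∘ETHR d innerProductMod2 (walshHadamard-affine d)) P))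
  where open Circuits ℝ
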